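{- Let $\mathcal{F}$ be a family of compact convex sets in $\mathbb{R}^d$. If among every $\aleph_0$ members of $\mathcal{F}$ some $d+1$ contain a point in their intersection with integer coordinates, then all the members of $\mathcal{F}$ can be hit by finitely many points with integer coordinates.
   Context: The hypothesis means that among any infinitely many members of $\mathcal{F}$ there are $d+1$ whose common intersection contains a point of $\mathbb{Z}^d$. A set is hit by a point if it contains that point.
   Formalization: The formal theorem additionally assumes that every member of the family contains a point with integer coordinates; without this the claim fails, e.g. for d = 1 and the family whose only member is {1/2}, and the condition is implied by the conclusion. -}

module Defs where

open import Level using (Level; 0ℓ; _⊔_) renaming (suc to lsuc)
open import Data.Nat.Base as ℕ using (ℕ)
import Data.Nat.Properties as ℕ
open import Data.Integer.Base using (ℤ)
open import Data.Rational.Base as ℚ using (ℚ; 0ℚ; 1ℚ; ½; ∣_∣; 1/_)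
import Data.Rational.Properties as ℚ
open import Data.Rational.Solver using (module +-*-Solver)
open import Data.Fin.Base using (Fin)
open import Data.List.Base using (List)
open import Data.List.Relation.Unary.Any using (Any)
open import Data.Product.Base using (Σ; _×_; _,_; ∃-syntax)
open import Data.Vec.Functional using (Vector)
open import Data.Vec.Functional.Relation.Binary.Pointwise using (Pointwise)
open import Function.Base using (_∘_)
open import Function.Definitions using (Injective)
open import Relation.Binary.Core using (Rel)
open import Relation.Binary.Definitions using (_Respects_)
open import Relation.Binary.PropositionalEquality
  using (_≡_; _≢_; refl; sym; trans; cong; cong₂; subst)
open import Relation.Nullary.Negation.Core using (¬_)
import Relation.Unary as U
open import Relation.Unary using (Pred)

Cauchy : (ℕ → ℚ) → Set
Cauchy u = ∀ ε → 0ℚ ℚ.< ε →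
  ∃[ N ] (∀ m n → N ℕ.≤ m → N ℕ.≤ n → ∣ u m ℚ.- u n ∣ ℚ.< ε)

-- A real number is a Cauchy sequence of rationals; the equality is _≃_
-- below, and with excluded middle this is the usual ordered field ℝ.
record ℝ : Set where
  constructor mkℝ
  field
    seq    : ℕ → ℚ
    cauchy : Cauchy seq

open ℝ public

infix 4 _≃_ _<_ _≤_

_≃_ : Rel ℝ 0ℓ
x ≃ y = ∀ ε → 0ℚ ℚ.< ε →
  ∃[ N ] (∀ n → N ℕ.≤ n → ∣ seq x n ℚ.- seq y n ∣ ℚ.< ε)

_<_ : Rel ℝ 0ℓ
x < y = ∃[ ε ] (0ℚ ℚ.< ε × ∃[ N ] (∀ n → N ℕ.≤ n → seq x n ℚ.+ ε ℚ.< seq y n))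

_≤_ : Rel ℝ 0ℓ
x ≤ y = ¬ (y < x)

fromℚ : ℚ → ℝ
fromℚ q = mkℝ (λ _ → q) λ ε 0<ε →
  0 , λ _ _ _ _ → subst (λ r → ∣ r ∣ ℚ.< ε) (sym (ℚ.+-inverseʳ q)) 0<ε

fromℤ : ℤ → ℝ
fromℤ k = fromℚ (k ℚ./ 1)

0ℝ 1ℝ : ℝ
0ℝ = fromℚ 0ℚ
1ℝ = fromℚ 1ℚ

private

  halve : ∀ ε → 0ℚ ℚ.< ε → ∃[ δ ] (0ℚ ℚ.< δ × δ ℚ.+ δ ≡ ε)
  halve ε 0<ε = ½ ℚ.* ε
    , subst (ℚ._< ½ ℚ.* ε) (ℚ.*-zeroʳ ½) (ℚ.*-monoʳ-<-pos ½ 0<ε)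
    , trans (sym (ℚ.*-distribʳ-+ ε ½ ½)) (ℚ.*-identityˡ ε)

  open +-*-Solver using (solve; _:=_; _:+_; _:-_; _:*_)

  +-regroup : ∀ a b c d →
    (a ℚ.+ b) ℚ.- (c ℚ.+ d) ≡ (a ℚ.- c) ℚ.+ (b ℚ.- d)
  +-regroup = solve 4
    (λ a b c d → (a :+ b) :- (c :+ d) := (a :- c) :+ (b :- d)) refl

  *-regroup : ∀ a b c d →
    a ℚ.* b ℚ.- c ℚ.* d ≡ (a ℚ.- c) ℚ.* b ℚ.+ (b ℚ.- d) ℚ.* c
  *-regroup = solve 4
    (λ a b c d → a :* b :- c :* d := (a :- c) :* b :+ (b :- d) :* c) refl

  split : ∀ a b → a ≡ (a ℚ.- b) ℚ.+ b
  split = solve 2 (λ a b → a := (a :- b) :+ b) refl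

  -‿cauchy : ∀ u → Cauchy u → Cauchy (ℚ.-_ ∘ u)
  -‿cauchy u cu ε 0<ε with cu ε 0<ε
  ... | N , h = N , λ m n N≤m N≤n →
    subst (ℚ._< ε)
      (trans (sym (ℚ.∣-p∣≡∣p∣ (u m ℚ.- u n)))
             (cong ∣_∣ (ℚ.neg-distrib-+ (u m) (ℚ.- u n))))
      (h m n N≤m N≤n)

  +-cauchy : ∀ u v → Cauchy u → Cauchy v → Cauchy (λ n → u n ℚ.+ v n)
  +-cauchy u v cu cv ε 0<ε
    with halve ε 0<ε
  ... | δ , 0<δ , δ+δ≡ε
    with cu δ 0<δ | cv δ 0<δ
  ... | M , g | N , h = M ℕ.⊔ N , λ m n p q → begin-strict
      ∣ (u m ℚ.+ v m) ℚ.- (u n ℚ.+ v n) ∣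
        ≡⟨ cong ∣_∣ (+-regroup (u m) (v m) (u n) (v n)) ⟩
      ∣ (u m ℚ.- u n) ℚ.+ (v m ℚ.- v n) ∣
        ≤⟨ ℚ.∣p+q∣≤∣p∣+∣q∣ (u m ℚ.- u n) (v m ℚ.- v n) ⟩
      ∣ u m ℚ.- u n ∣ ℚ.+ ∣ v m ℚ.- v n ∣
        <⟨ ℚ.+-mono-< (g m n (ℕ.m⊔n≤o⇒m≤o M N p) (ℕ.m⊔n≤o⇒m≤o M N q))
                      (h m n (ℕ.m⊔n≤o⇒n≤o M N p) (ℕ.m⊔n≤o⇒n≤o M N q)) ⟩
      δ ℚ.+ δ
        ≡⟨ δ+δ≡ε ⟩
      ε ∎
    where open ℚ.≤-Reasoning

  eventuallyBounded : ∀ u → Cauchy u →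
    ∃[ B ] (0ℚ ℚ.< B × ∃[ N ] (∀ n → N ℕ.≤ n → ∣ u n ∣ ℚ.< B))
  eventuallyBounded u cu with cu 1ℚ (ℚ.positive⁻¹ 1ℚ)
  ... | N , h = 1ℚ ℚ.+ ∣ u N ∣
      , ℚ.+-mono-<-≤ (ℚ.positive⁻¹ 1ℚ) (ℚ.0≤∣p∣ (u N))
      , N , λ n N≤n → begin-strict
      ∣ u n ∣
        ≡⟨ cong ∣_∣ (split (u n) (u N)) ⟩
      ∣ (u n ℚ.- u N) ℚ.+ u N ∣
        ≤⟨ ℚ.∣p+q∣≤∣p∣+∣q∣ (u n ℚ.- u N) (u N) ⟩
      ∣ u n ℚ.- u N ∣ ℚ.+ ∣ u N ∣
        <⟨ ℚ.+-monoˡ-< ∣ u N ∣ (h n N N≤n ℕ.≤-refl) ⟩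
      1ℚ ℚ.+ ∣ u N ∣ ∎
    where open ℚ.≤-Reasoning

  ∣*∣-bound : ∀ p q {δ B} → 0ℚ ℚ.< B → ∣ p ∣ ℚ.< δ → ∣ q ∣ ℚ.< B →
              ∣ p ℚ.* q ∣ ℚ.< δ ℚ.* B
  ∣*∣-bound p q {δ} {B} 0<B p<δ q<B = begin-strict
      ∣ p ℚ.* q ∣      ≡⟨ ℚ.∣p*q∣≡∣p∣*∣q∣ p q ⟩
      ∣ p ∣ ℚ.* ∣ q ∣  ≤⟨ ℚ.*-monoˡ-≤-nonNeg ∣ p ∣ {{ℚ.nonNegative (ℚ.0≤∣p∣ p)}} (ℚ.<⇒≤ q<B) ⟩
      ∣ p ∣ ℚ.* B      <⟨ ℚ.*-monoˡ-<-pos B {{ℚ.positive 0<B}} p<δ ⟩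
      δ ℚ.* B          ∎
    where open ℚ.≤-Reasoning

  divide : ∀ ε B → 0ℚ ℚ.< ε → 0ℚ ℚ.< B → ∃[ δ ] (0ℚ ℚ.< δ × δ ℚ.* B ≡ ε)
  divide ε B 0<ε 0<B = ε ℚ.* 1/ B
      , subst (ℚ._< ε ℚ.* 1/ B) (ℚ.*-zeroˡ (1/ B))
          (ℚ.*-monoˡ-<-pos (1/ B) {{ℚ.1/pos⇒pos B}} 0<ε)
      , trans (ℚ.*-assoc ε (1/ B) B)
          (trans (cong (ε ℚ.*_) (ℚ.*-inverseˡ B)) (ℚ.*-identityʳ ε))
    where
    instance
      B-pos : ℚ.Positive B
      B-pos = ℚ.positive 0<B
      B-nonZero : ℚ.NonZero B
      B-nonZero = ℚ.pos⇒nonZero B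

  ∣*-*∣-bound : ∀ a b c d {α β A B δ ε} → 0ℚ ℚ.< A → 0ℚ ℚ.< B →
    ∣ a ℚ.- c ∣ ℚ.< α → ∣ b ∣ ℚ.< B → ∣ b ℚ.- d ∣ ℚ.< β → ∣ c ∣ ℚ.< A →
    α ℚ.* B ≡ δ → β ℚ.* A ≡ δ → δ ℚ.+ δ ≡ ε →
    ∣ a ℚ.* b ℚ.- c ℚ.* d ∣ ℚ.< ε
  ∣*-*∣-bound a b c d {α} {β} {A} {B} {δ} {ε}
    0<A 0<B ac<α b<B bd<β c<A αB≡δ βA≡δ δ+δ≡ε = begin-strict
      ∣ a ℚ.* b ℚ.- c ℚ.* d ∣
        ≡⟨ cong ∣_∣ (*-regroup a b c d) ⟩
      ∣ (a ℚ.- c) ℚ.* b ℚ.+ (b ℚ.- d) ℚ.* c ∣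
        ≤⟨ ℚ.∣p+q∣≤∣p∣+∣q∣ ((a ℚ.- c) ℚ.* b) ((b ℚ.- d) ℚ.* c) ⟩
      ∣ (a ℚ.- c) ℚ.* b ∣ ℚ.+ ∣ (b ℚ.- d) ℚ.* c ∣
        <⟨ ℚ.+-mono-< (∣*∣-bound (a ℚ.- c) b 0<B ac<α b<B)
                      (∣*∣-bound (b ℚ.- d) c 0<A bd<β c<A) ⟩
      α ℚ.* B ℚ.+ β ℚ.* A
        ≡⟨ cong₂ ℚ._+_ αB≡δ βA≡δ ⟩
      δ ℚ.+ δ
        ≡⟨ δ+δ≡ε ⟩
      ε ∎
    where open ℚ.≤-Reasoning

  *-cauchy : ∀ u v → Cauchy u → Cauchy v → Cauchy (λ n → u n ℚ.* v n)
  *-cauchy u v cu cv ε 0<ε =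
    bounds (eventuallyBounded u cu) (eventuallyBounded v cv) (halve ε 0<ε)
    where
    Goal : Set
    Goal = ∃[ N ] (∀ m n → N ℕ.≤ m → N ℕ.≤ n →
      ∣ u m ℚ.* v m ℚ.- u n ℚ.* v n ∣ ℚ.< ε)

    Bounded : (ℕ → ℚ) → Set
    Bounded w = ∃[ B ] (0ℚ ℚ.< B × ∃[ N ] (∀ n → N ℕ.≤ n → ∣ w n ∣ ℚ.< B))

    bounds : Bounded u → Bounded v → ∃[ δ ] (0ℚ ℚ.< δ × δ ℚ.+ δ ≡ ε) → Goal
    bounds (A , 0<A , K , u<A) (B , 0<B , L , v<B) (δ , 0<δ , δ+δ≡ε) =
      moduli (divide δ B 0<δ 0<B) (divide δ A 0<δ 0<A)
      where
      moduli : ∃[ α ] (0ℚ ℚ.< α × α ℚ.* B ≡ δ) →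
               ∃[ β ] (0ℚ ℚ.< β × β ℚ.* A ≡ δ) → Goal
      moduli (α , 0<α , αB≡δ) (β , 0<β , βA≡δ)
        with cu α 0<α | cv β 0<β
      ... | M , g | N , h = (K ℕ.⊔ L) ℕ.⊔ (M ℕ.⊔ N) , λ m n p q →
        let p₁ = ℕ.m⊔n≤o⇒m≤o (K ℕ.⊔ L) (M ℕ.⊔ N) p
            p₂ = ℕ.m⊔n≤o⇒n≤o (K ℕ.⊔ L) (M ℕ.⊔ N) p
            q₁ = ℕ.m⊔n≤o⇒m≤o (K ℕ.⊔ L) (M ℕ.⊔ N) q
            q₂ = ℕ.m⊔n≤o⇒n≤o (K ℕ.⊔ L) (M ℕ.⊔ N) q
        in ∣*-*∣-bound (u m) (v m) (u n) (v n) 0<A 0<B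
             (g m n (ℕ.m⊔n≤o⇒m≤o M N p₂) (ℕ.m⊔n≤o⇒m≤o M N q₂))
             (v<B m (ℕ.m⊔n≤o⇒n≤o K L p₁))
             (h m n (ℕ.m⊔n≤o⇒n≤o M N p₂) (ℕ.m⊔n≤o⇒n≤o M N q₂))
             (u<A n (ℕ.m⊔n≤o⇒m≤o K L q₁))
             αB≡δ βA≡δ δ+δ≡ε

infixl 6 _+_ _-_
infixl 7 _*_
infix  8 -_

_+_ _*_ : ℝ → ℝ → ℝ
x + y = mkℝ (λ n → seq x n ℚ.+ seq y n)
            (+-cauchy (seq x) (seq y) (cauchy x) (cauchy y))
x * y = mkℝ (λ n → seq x n ℚ.* seq y n)
            (*-cauchy (seq x) (seq y) (cauchy x) (cauchy y))

-_ : ℝ → ℝ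
- x = mkℝ (λ n → ℚ.- seq x n) (-‿cauchy (seq x) (cauchy x))

_-_ : ℝ → ℝ → ℝ
x - y = x + (- y)

Space : ℕ → Set
Space d = Vector ℝ d

infix 4 _≈_

_≈_ : ∀ {d} → Rel (Space d) 0ℓ
_≈_ = Pointwise _≃_

-- Sets of points must not distinguish between equal points.
record PointSet (d : ℕ) : Set₁ where
  field
    member : Pred (Space d) 0ℓ
    resp   : member Respects _≈_

open PointSet public

infix 4 _∈_ _≐_

_∈_ : ∀ {d} → Space d → PointSet d → Set
x ∈ K = member K x

_≐_ : ∀ {d} → Rel (PointSet d) 0ℓ
K ≐ L = member K U.≐ member L

Convex : ∀ {d} → PointSet d → Set
Convex K = ∀ x y t → x ∈ K → y ∈ K → 0ℝ ≤ t → t ≤ 1ℝ →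
  (λ i → t * x i + (1ℝ - t) * y i) ∈ K

-- The product topology: the cubes around x form a neighbourhood base.
Open : ∀ {d} → PointSet d → Set
Open V = ∀ x → x ∈ V →
  ∃[ ε ] (0ℝ < ε × (∀ y → (∀ i → x i - ε < y i × y i < x i + ε) → y ∈ V))

Compact : ∀ {d} → PointSet d → Set₁
Compact {d} K = (I : Set) (V : I → PointSet d) → (∀ i → Open (V i)) →
  (∀ x → x ∈ K → ∃[ i ] x ∈ V i) →
  ∃[ is ] (∀ x → x ∈ K → Any (λ i → x ∈ V i) is)

IntPoint : ℕ → Set
IntPoint d = Vector ℤ d

⟦_⟧ : ∀ {d} → IntPoint d → Space d
⟦ z ⟧ i = fromℤ (z i)

Hits : ∀ {d} → IntPoint d → PointSet d → Set
Hits z K = ⟦ z ⟧ ∈ K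

Family : ℕ → (ℓ : Level) → Set (lsuc 0ℓ ⊔ lsuc ℓ)
Family d ℓ = Pred (PointSet d) ℓ

-- Among any infinitely many members of 𝓕, some q have a common integer
-- point.  Infinitely many members are given as a sequence of pairwise
-- different sets; the q members are chosen by different indices.
AmongInfinitelyMany : ∀ {d ℓ} → ℕ → Family d ℓ → Set (lsuc 0ℓ ⊔ ℓ)
AmongInfinitelyMany {d} q 𝓕 = (K : ℕ → PointSet d) →
  (∀ n → 𝓕 (K n)) → (∀ m n → m ≢ n → ¬ (K m ≐ K n)) →
  Σ (Fin q → ℕ) λ σ → Injective _≡_ _≡_ σ ×
    ∃[ z ] (∀ j → Hits z (K (σ j)))

FinitelyHit : ∀ {d ℓ} → Family d ℓ → Set (lsuc 0ℓ ⊔ ℓ)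
FinitelyHit {d} 𝓕 = Σ (List (IntPoint d)) λ zs →
  ∀ K → 𝓕 K → Any (λ z → Hits z K) zs

{-# OPTIONS --safe #-}

-- A compact set contains only finitely many integer points. So if no finite
-- set of integer points hits 𝓕, members K₀, K₁, … can be chosen greedily such
-- that Kₙ avoids every integer point of K₀, …, Kₙ₋₁. No two members of this
-- sequence share an integer point, which contradicts the hypothesis as soon as
-- d + 1 ≥ 2. For d = 0 there is only one integer point.
module Submission where

open import Level using (Level; 0ℓ; _⊔_; Lift; lift; lower) renaming (suc to lsuc)
open import Axiom.ExcludedMiddle using (ExcludedMiddle)
open import Axiom.DoubleNegationElimination using (em⇒dne)
open import Data.Empty using (⊥-elim)
open import Data.Fin.Base using (zero; suc)
open import Data.Fin.Properties using (0≢1+n)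
open import Data.Integer.Base as ℤ using (+_)
import Data.Integer.Properties as ℤ
open import Data.List.Base using (List; []; _∷_; _++_)
open import Data.List.Relation.Unary.Any as Any using (Any; here; there)
open import Data.List.Relation.Unary.Any.Properties using (++⁺ˡ; ++⁺ʳ)
open import Data.Nat.Base as ℕ using (ℕ; zero; suc)
import Data.Nat.Properties as ℕ
open import Data.Product.Base using (_×_; _,_; proj₁; proj₂; ∃-syntax)
open import Data.Rational.Base as ℚ using (ℚ; 0ℚ; 1ℚ; ½; ∣_∣; toℚᵘ)
import Data.Rational.Properties as ℚ
open import Data.Rational.Solver using (module +-*-Solver)
open import Data.Rational.Unnormalised.Base as ℚᵘ using (mkℚᵘ)
import Data.Rational.Unnormalised.Properties as ℚᵘ
open import Data.Sum.Base using (inj₁; inj₂)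
open import Function.Base using (_∘_)
open import Relation.Binary.Definitions using (tri<; tri≈; tri>)
open import Relation.Binary.PropositionalEquality
  using (_≡_; _≢_; _≗_; refl; sym; trans; cong; subst)
open import Relation.Nullary.Decidable.Core using (yes; no; map′)
open import Relation.Nullary.Negation.Core using (¬_)
open import Defs

open +-*-Solver using (solve; _:=_; _:+_; _:-_; :-_)

-- Universe levels and rational estimates

lower-em : ∀ {a} b → ExcludedMiddle (a ⊔ b) → ExcludedMiddle a
lower-em b em = map′ lower lift (em {Lift b _})

-- Over the unnormalised rationals both denominators are literally 1, so the bound says that a
-- natural number is below 1.
/1-injective : ∀ k l → ∣ k ℚ./ 1 ℚ.- l ℚ./ 1 ∣ ℚ.< 1ℚ → k ≡ l
/1-injective k l h = ℤ.i-j≡0⇒i≡j k l (ℤ.∣i∣≡0⇒i≡0 (ℕ.n<1⇒n≡0 (ℤ.drop‿+<+ ∣k-l∣<1)))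
  where
  norm : toℚᵘ ∣ k ℚ./ 1 ℚ.- l ℚ./ 1 ∣ ℚᵘ.≃ ℚᵘ.∣ mkℚᵘ k 0 ℚᵘ.- mkℚᵘ l 0 ∣
  norm = ℚᵘ.≃-trans (ℚ.toℚᵘ-homo-∣-∣ (k ℚ./ 1 ℚ.- l ℚ./ 1))
    (ℚᵘ.∣-∣-cong (ℚᵘ.≃-trans (ℚ.toℚᵘ-homo-+ (k ℚ./ 1) (ℚ.- (l ℚ./ 1)))
      (ℚᵘ.+-cong (ℚ.toℚᵘ-fromℚᵘ (mkℚᵘ k 0))
        (ℚᵘ.≃-trans (ℚ.toℚᵘ-homo‿- (l ℚ./ 1))
          (ℚᵘ.-‿cong (ℚ.toℚᵘ-fromℚᵘ (mkℚᵘ l 0)))))))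

  simplify : (+ ℤ.∣ k ℤ.* + 1 ℤ.+ (ℤ.- l) ℤ.* + 1 ∣) ℤ.* + 1 ≡ + ℤ.∣ k ℤ.- l ∣
  simplify = trans (ℤ.*-identityʳ _)
    (cong (λ i → + ℤ.∣ i ∣)
      (trans (cong (ℤ._+ (ℤ.- l) ℤ.* + 1) (ℤ.*-identityʳ k))
             (cong (λ i → k ℤ.+ i) (ℤ.*-identityʳ (ℤ.- l)))))

  ∣k-l∣<1 : + ℤ.∣ k ℤ.- l ∣ ℤ.< + 1
  ∣k-l∣<1 = subst (ℤ._< + 1) simplify
    (ℚᵘ.drop-*<* (ℚᵘ.<-respˡ-≃ norm (ℚ.toℚᵘ-mono-< h)))

∣p∣<r : ∀ p {r} → p ℚ.< r → ℚ.- p ℚ.< r → ∣ p ∣ ℚ.< r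
∣p∣<r p p<r -p<r with ℚ.∣p∣≡p∨∣p∣≡-p p
... | inj₁ eq = subst (ℚ._< _) (sym eq) p<r
... | inj₂ eq = subst (ℚ._< _) (sym eq) -p<r

0<q-p : ∀ {p q} → p ℚ.< q → 0ℚ ℚ.< q ℚ.- p
0<q-p {p} {q} p<q =
  subst (ℚ._< q ℚ.- p) (ℚ.+-inverseʳ p) (ℚ.+-monoˡ-< (ℚ.- p) p<q)

p+[q-p]≡q : ∀ p q → p ℚ.+ (q ℚ.- p) ≡ q
p+[q-p]≡q = solve 2 (λ p q → p :+ (q :- p) := q) refl

-- Closeness of reals at a rational radius

-- `x ≃ y` unfolds to `Near ε x y` for all positive `ε`. At a single radius it is termwise, so the
-- limits may be at distance exactly `r`.
Near : ℚ → ℝ → ℝ → Set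
Near r x y = ∃[ N ] (∀ n → N ℕ.≤ n → ∣ seq x n ℚ.- seq y n ∣ ℚ.< r)

near-refl : ∀ {r} x → 0ℚ ℚ.< r → Near r x x
near-refl x 0<r = 0 , λ n _ →
  subst (λ p → ∣ p ∣ ℚ.< _) (sym (ℚ.+-inverseʳ (seq x n))) 0<r

near-sym : ∀ {r} x y → Near r x y → Near r y x
near-sym {r} x y (N , h) = N , λ n N≤n → subst (ℚ._< r)
  (trans (sym (ℚ.∣-p∣≡∣p∣ (seq x n ℚ.- seq y n)))
         (cong ∣_∣ (flip (seq x n) (seq y n))))
  (h n N≤n)
  where
  flip : ∀ p q → ℚ.- (p ℚ.- q) ≡ q ℚ.- p
  flip = solve 2 (λ p q → :- (p :- q) := q :- p) refl

near-trans : ∀ {r s} x y z → Near r x y → Near s y z → Near (r ℚ.+ s) x z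
near-trans {r} {s} x y z (M , g) (N , h) = M ℕ.⊔ N , λ n p → begin-strict
  ∣ seq x n ℚ.- seq z n ∣
    ≡⟨ cong ∣_∣ (via (seq x n) (seq y n) (seq z n)) ⟩
  ∣ (seq x n ℚ.- seq y n) ℚ.+ (seq y n ℚ.- seq z n) ∣
    ≤⟨ ℚ.∣p+q∣≤∣p∣+∣q∣ (seq x n ℚ.- seq y n) (seq y n ℚ.- seq z n) ⟩
  ∣ seq x n ℚ.- seq y n ∣ ℚ.+ ∣ seq y n ℚ.- seq z n ∣
    <⟨ ℚ.+-mono-< (g n (ℕ.m⊔n≤o⇒m≤o M N p)) (h n (ℕ.m⊔n≤o⇒n≤o M N p)) ⟩
  r ℚ.+ s ∎
  where
  open ℚ.≤-Reasoning
  via : ∀ a b c → a ℚ.- c ≡ (a ℚ.- b) ℚ.+ (b ℚ.- c)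
  via = solve 3 (λ a b c → a :- c := (a :- b) :+ (b :- c)) refl

fromℚ-positive : ∀ {ε} → 0ℚ ℚ.< ε → 0ℝ < fromℚ ε
fromℚ-positive 0<ε with ℚ.<-dense 0<ε
-- The gap witnessing `<` on reals must stay strictly below `ε`.
... | δ , 0<δ , δ<ε = δ , 0<δ , 0 , λ _ _ →
  subst (ℚ._< _) (sym (ℚ.+-identityˡ δ)) δ<ε

-- Translates the real inequalities of `Open` into `Near`; the positive gaps `α` and `β` can simply
-- be dropped.
interval⇒near : ∀ {ε} x y → x - fromℚ ε < y → y < x + fromℚ ε → Near ε x y
interval⇒near {ε} x y (α , 0<α , M , g) (β , 0<β , N , h) =
  M ℕ.⊔ N , λ n p → ∣p∣<r (seq x n ℚ.- seq y n)
    (below (seq x n) (seq y n) (g n (ℕ.m⊔n≤o⇒m≤o M N p)))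
    (above (seq x n) (seq y n) (h n (ℕ.m⊔n≤o⇒n≤o M N p)))
  where
  open ℚ.≤-Reasoning

  p<p+δ : ∀ p {δ} → 0ℚ ℚ.< δ → p ℚ.< p ℚ.+ δ
  p<p+δ p {δ} 0<δ = subst (ℚ._< p ℚ.+ δ) (ℚ.+-identityʳ p) (ℚ.+-monoʳ-< p 0<δ)

  below : ∀ a b → a ℚ.- ε ℚ.+ α ℚ.< b → a ℚ.- b ℚ.< ε
  below a b lt = begin-strict
    a ℚ.- b
      ≡⟨ solve 3 (λ a b ε → a :- b := (a :- ε) :+ (ε :- b)) refl a b ε ⟩
    (a ℚ.- ε) ℚ.+ (ε ℚ.- b)
      <⟨ ℚ.+-monoˡ-< (ε ℚ.- b) (ℚ.<-trans (p<p+δ (a ℚ.- ε) 0<α) lt) ⟩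
    b ℚ.+ (ε ℚ.- b)
      ≡⟨ p+[q-p]≡q b ε ⟩
    ε ∎

  above : ∀ a b → b ℚ.+ β ℚ.< a ℚ.+ ε → ℚ.- (a ℚ.- b) ℚ.< ε
  above a b lt = begin-strict
    ℚ.- (a ℚ.- b)
      ≡⟨ solve 2 (λ a b → :- (a :- b) := b :- a) refl a b ⟩
    b ℚ.- a
      <⟨ ℚ.+-monoˡ-< (ℚ.- a) (ℚ.<-trans (p<p+δ b 0<β) lt) ⟩
    (a ℚ.+ ε) ℚ.- a
      ≡⟨ solve 2 (λ a ε → (a :+ ε) :- a := ε) refl a ε ⟩
    ε ∎

-- Integer points in unit cubes and in compact sets

near⇒≡ : ∀ k l {r} → r ℚ.< 1ℚ → Near r (fromℤ k) (fromℤ l) → k ≡ l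
near⇒≡ k l r<1 (N , near) = /1-injective k l (ℚ.<-trans (near N ℕ.≤-refl) r<1)

-- The radius r is uniform in the coordinates so that openness needs no
-- minimum over them.
cube : ∀ {d} → Space d → PointSet d
cube c .member x = ∃[ r ] (r ℚ.< ½ × (∀ i → Near r (c i) (x i)))
cube c .resp {x} {y} x≈y (r , r<½ , near) with ℚ.<-dense r<½
... | s , r<s , s<½ = s , s<½ , λ i →
  subst (λ t → Near t (c i) (y i)) (p+[q-p]≡q r s)
    (near-trans (c i) (x i) (y i) (near i) (x≈y i (s ℚ.- r) (0<q-p r<s)))

-- A point at radius `r` leaves room up to some `s` with `r < s < ½`, so a neighbourhood of
-- half-width `s - r` fits.
cube-open : ∀ {d} (c : Space d) → Open (cube c)
cube-open c x (r , r<½ , near) with ℚ.<-dense r<½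
... | s , r<s , s<½ = fromℚ (s ℚ.- r) , fromℚ-positive (0<q-p r<s) , λ y x≈y →
  s , s<½ , λ i → subst (λ t → Near t (c i) (y i)) (p+[q-p]≡q r s)
    (near-trans (c i) (x i) (y i) (near i)
      (interval⇒near (x i) (y i) (proj₁ (x≈y i)) (proj₂ (x≈y i))))

centre∈cube : ∀ {d} (c : Space d) → c ∈ cube c
centre∈cube c with ℚ.<-dense (ℚ.positive⁻¹ ½)
... | r , 0<r , r<½ = r , r<½ , λ i → near-refl (c i) 0<r

-- Two points of the cube differ by less than ½ + ½ = 1 in each coordinate.
cube-intPoint-unique : ∀ {d} (c : Space d) {z w : IntPoint d} →
  Hits z (cube c) → Hits w (cube c) → z ≗ w
cube-intPoint-unique c {z} {w} (r , r<½ , c~z) (s , s<½ , c~w) i =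
  near⇒≡ (z i) (w i) (ℚ.+-mono-< r<½ s<½)
    (near-trans (⟦ z ⟧ i) (c i) (⟦ w ⟧ i) (near-sym (c i) (⟦ z ⟧ i) (c~z i)) (c~w i))

hits-resp-≗ : ∀ {d} (K : PointSet d) {z w : IntPoint d} →
  z ≗ w → Hits z K → Hits w K
hits-resp-≗ K {z} {w} z≗w = resp K λ i →
  subst (λ k → fromℤ (z i) ≃ fromℤ k) (z≗w i)
    (λ ε 0<ε → near-refl (fromℤ (z i)) 0<ε)

-- The list must be complete, but may also hold points outside `K`.
FinitelyManyIntPoints : ∀ {d} → PointSet d → Set
FinitelyManyIntPoints K = ∃[ zs ] (∀ z → Hits z K → Any (z ≗_) zs)

module _ (em : ExcludedMiddle 0ℓ) where

  intPoints-in-cubes : ∀ {d} (cs : List (Space d)) →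
    ∃[ zs ] (∀ z → Any (λ c → Hits z (cube c)) cs → Any (z ≗_) zs)
  intPoints-in-cubes [] = [] , λ _ ()
  intPoints-in-cubes (c ∷ cs)
    with intPoints-in-cubes cs | em {∃[ w ] Hits w (cube c)}
  ... | zs , complete | yes (w , w∈c) = w ∷ zs , λ where
    z (here z∈c)   → here (cube-intPoint-unique c z∈c w∈c)
    z (there z∈cs) → there (complete z z∈cs)
  ... | zs , complete | no empty = zs , λ where
    z (here z∈c)   → ⊥-elim (empty (z , z∈c))
    z (there z∈cs) → complete z z∈cs

  -- The cubes around all points of the space cover `K`; finitely many suffice, and each has at most
  -- one integer point.
  compact⇒finitelyManyIntPoints : ∀ {d} (K : PointSet d) →
    Compact K → FinitelyManyIntPoints K
  compact⇒finitelyManyIntPoints K compact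
    with compact _ cube cube-open (λ x _ → x , centre∈cube x)
  ... | cs , covers with intPoints-in-cubes cs
  ...   | zs , complete = zs , λ z z∈K → complete z (covers ⟦ z ⟧ z∈K)

-- The greedy sequence

module Greedy {d ℓ} (𝓕 : Family d ℓ)
  (finite : ∀ K → 𝓕 K → FinitelyManyIntPoints K)
  (unhit : ∀ zs → ∃[ K ] (𝓕 K × ¬ Any (λ z → Hits z K) zs))
  where

  mutual

    -- The recursion descends only here: `chosen n` and `chosen∈𝓕 n` consult `avoided` at the same
    -- index.
    avoided : ℕ → List (IntPoint d)
    avoided zero    = []
    avoided (suc n) = proj₁ (finite (chosen n) (chosen∈𝓕 n)) ++ avoided n

    chosen : ℕ → PointSet d
    chosen n = proj₁ (unhit (avoided n))

    chosen∈𝓕 : ∀ n → 𝓕 (chosen n)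
    chosen∈𝓕 n = proj₁ (proj₂ (unhit (avoided n)))

  -- The two constructors of `<′` match the two halves of `avoided (suc n)`: the points of the
  -- newest member and those listed before.
  earlier-avoided : ∀ {m n} → m ℕ.<′ n → ∀ z → Hits z (chosen m) →
    Any (z ≗_) (avoided n)
  earlier-avoided {m} ℕ.<′-base z z∈K =
    ++⁺ˡ (proj₂ (finite (chosen m) (chosen∈𝓕 m)) z z∈K)
  earlier-avoided {n = suc n} (ℕ.<′-step m<n) z z∈K =
    ++⁺ʳ (proj₁ (finite (chosen n) (chosen∈𝓕 n))) (earlier-avoided m<n z z∈K)

  <⇒disjoint : ∀ {m n} → m ℕ.< n → ∀ z → Hits z (chosen m) → ¬ Hits z (chosen n)
  <⇒disjoint {n = n} m<n z z∈Kₘ z∈Kₙ = proj₂ (proj₂ (unhit (avoided n)))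
    (Any.map (λ z≗w → hits-resp-≗ (chosen n) z≗w z∈Kₙ)
      (earlier-avoided (ℕ.<⇒<′ m<n) z z∈Kₘ))

  ≢⇒disjoint : ∀ {m n} → m ≢ n → ∀ z → Hits z (chosen m) → ¬ Hits z (chosen n)
  ≢⇒disjoint {m} {n} m≢n z z∈Kₘ z∈Kₙ with ℕ.<-cmp m n
  ... | tri< m<n _ _ = <⇒disjoint m<n z z∈Kₘ z∈Kₙ
  ... | tri≈ _ m≡n _ = m≢n m≡n
  ... | tri> _ _ n<m = <⇒disjoint n<m z z∈Kₙ z∈Kₘ

  contradicts : ∀ {q} → (∀ K → 𝓕 K → ∃[ z ] Hits z K) →
    ¬ AmongInfinitelyMany (suc (suc q)) 𝓕
  contradicts nonempty among with among chosen chosen∈𝓕 distinct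
    where
    -- Equal members would share an integer point, since each has one.
    distinct : ∀ m n → m ≢ n → ¬ (chosen m ≐ chosen n)
    distinct m n m≢n (Kₘ⊆Kₙ , _) with nonempty (chosen m) (chosen∈𝓕 m)
    ... | z , z∈Kₘ = ≢⇒disjoint m≢n z z∈Kₘ (Kₘ⊆Kₙ z∈Kₘ)
  ... | σ , σ-injective , z , hits =
    -- Positions 0 and 1 exist in `Fin (suc (suc q))`, and `σ` keeps them apart.
    ≢⇒disjoint (0≢1+n ∘ σ-injective) z (hits zero) (hits (suc zero))

corollary7 : ∀ {ℓ : Level} → ExcludedMiddle (lsuc 0ℓ ⊔ ℓ) →
    (d : ℕ) (𝓕 : Family d ℓ) →
    (∀ K → 𝓕 K → Compact K) →
    (∀ K → 𝓕 K → Convex K) →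
    (∀ K → 𝓕 K → ∃[ z ] Hits z K) →
    AmongInfinitelyMany (suc d) 𝓕 →
    FinitelyHit 𝓕
corollary7 em zero 𝓕 compact convex nonempty among =
  (λ ()) ∷ [] , λ K K∈𝓕 →
    -- Over no coordinates equality of points is vacuous, so the integer point of `K` may be
    -- replaced by `λ ()`.
    here (resp K (λ ()) (proj₂ (nonempty K K∈𝓕)))
corollary7 {ℓ} em (suc d) 𝓕 compact convex nonempty among =
  em⇒dne em λ ¬finitelyHit →
    Greedy.contradicts 𝓕
      (λ K K∈𝓕 → compact⇒finitelyManyIntPoints em₀ K (compact K K∈𝓕))
      -- If `zs` missed no member, it would hit them all. The missed member ranges over `PointSet`,
      -- hence `em`; a hit in `zs` lives in `Set`, hence `em₀`.
      (λ zs → em⇒dne em λ allHit → ¬finitelyHit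
        (zs , λ K K∈𝓕 → em⇒dne em₀ λ ¬hit → allHit (K , K∈𝓕 , ¬hit)))
      nonempty among
  where
  em₀ : ExcludedMiddle 0ℓ
  em₀ = lower-em (lsuc 0ℓ ⊔ ℓ) em
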